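{- Let $\mathcal{B}$ be the set of all blocking games. If $G\in\mathcal{P}_{\mathcal{B}}(\mathcal{B})$, then $G$ is $\mathcal{B}$-invertible. That is, $\mathcal{P}_{\mathcal{B}}(\mathcal{B})\leq\mathcal{B}^\times$.
   Context: Games are short combinatorial game forms played under the misère convention (a player unable to move wins). Outcomes $o(G)\in\{\mathscr{L},\mathscr{N},\mathscr{P},\mathscr{R}\}$ as usual ($\mathscr{P}$: second player wins), partially ordered by $\mathscr{L}>\mathscr{N}>\mathscr{R}$, $\mathscr{L}>\mathscr{P}>\mathscr{R}$, $\mathscr{N}$ and $\mathscr{P}$ incomparable. $G+H$ is the disjunctive sum, $\overline{G}$ the conjugate (roles swapped), $0=\{\cdot\mid\cdot\}$. A subposition of $G$ is any game reachable from $G$ by a possibly empty, not necessarily alternating, sequence of moves. A game is strictly $\mathscr{P}$-free if no subposition has outcome $\mathscr{P}$. For a set $\mathcal{A}$, $G\geq_{\mathcal{A}}H$ iff $o(G+X)\geq o(H+X)$ for all $X\in\mathcal{A}$, and $\equiv_{\mathcal{A}}$ is the associated equivalence. $\mathcal{P}_{\mathcal{A}}(\mathcal{A})$ is the set of $G\in\mathcal{A}$ with $G\equiv_{\mathcal{A}}H$ for some strictly $\mathscr{P}$-free $H\in\mathcal{A}$. A Left end is a game with no Left options. A Left end $X$ is blocked if for every Right option $X^R$, either $X^R$ is a blocked Left end or some Left option $X^{RL}$ of $X^R$ is a blocked Left end; blocked Right ends symmetrically. A game is blocking if every subposition that is a Left (resp. Right) end is a blocked Left (resp. Right) end; $\mathcal{B}$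 is the set of blocking games. $G\in\mathcal{A}$ is $\mathcal{A}$-invertible if there is $H\in\mathcal{A}$ with $G+H\equiv_{\mathcal{A}}0$; $\mathcal{A}^\times$ is the set of $\mathcal{A}$-invertible elements. For $T\subseteq\mathcal{A}$, $T\leq\mathcal{A}^\times$ means $T\subseteq\mathcal{A}^\times$ and the $\equiv_{\mathcal{A}}$-classes of elements of $T$ form a subgroup of the group of $\equiv_{\mathcal{A}}$-classes of $\mathcal{A}^\times$ under $+$. -}

module Defs where

open import Data.Nat using (ℕ; zero; suc)
import Data.Nat as ℕ
open import Data.Fin using (Fin; splitAt)
open import Data.Bool using (Bool; true; false; _∧_; _∨_; not)
open import Data.Sum using (_⊎_; [_,_]′)
open import Data.Product using (Σ; ∃; _×_; _,_)
open import Data.Empty using (⊥)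
open import Data.Unit using (⊤)
open import Relation.Nullary using (¬_)
open import Relation.Binary.PropositionalEquality using (_≡_)

-- Short game forms: finitely many Left options and Right options.
data Game : Set where
  mk : (m n : ℕ) → (Fin m → Game) → (Fin n → Game) → Game

nL : Game → ℕ
nL (mk m _ _ _) = m

nR : Game → ℕ
nR (mk _ n _ _) = n

𝟘 : Game
𝟘 = mk 0 0 (λ ()) (λ ())

anyF : (k : ℕ) → (Fin k → Bool) → Bool
anyF zero f = false
anyF (suc k) f = f Fin.zero ∨ anyF k (λ i → f (Fin.suc i))

allF : (k : ℕ) → (Fin k → Bool) → Bool
allF zero f = true
allF (suc k) f = f Fin.zero ∧ allF k (λ i → f (Fin.suc i))

-- Misère play.
-- leftFirst G  : Left wins G when Left moves first.
-- leftSecond G : Left wins G when Right moves first.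
-- A player unable to move wins.
mutual
  leftFirst : Game → Bool
  leftFirst (mk zero n L R) = true
  leftFirst (mk (suc m) n L R) = anyF (suc m) (λ i → leftSecond (L i))

  leftSecond : Game → Bool
  leftSecond (mk m zero L R) = false
  leftSecond (mk m (suc n) L R) = allF (suc n) (λ j → leftFirst (R j))

data Outcome : Set where
  𝓛 𝓝 𝓟 𝓡 : Outcome

outcomeOf : Bool → Bool → Outcome
outcomeOf true  true  = 𝓛
outcomeOf true  false = 𝓝
outcomeOf false true  = 𝓟
outcomeOf false false = 𝓡

o : Game → Outcome
o G = outcomeOf (leftFirst G) (leftSecond G)

data _≥o_ : Outcome → Outcome → Set where
  ≥o-refl : ∀ {x} → x ≥o x
  𝓛≥ : ∀ {x} → 𝓛 ≥o x
  ≥𝓡 : ∀ {x} → x ≥o 𝓡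

_+_ : Game → Game → Game
mk m n L R + mk m' n' L' R' =
  mk (m ℕ.+ m') (n ℕ.+ n')
     (λ k → [ (λ i → L i + mk m' n' L' R') , (λ i → mk m n L R + L' i) ]′ (splitAt m k))
     (λ k → [ (λ j → R j + mk m' n' L' R') , (λ j → mk m n L R + R' j) ]′ (splitAt n k))

infixl 6 _+_

data Sub : Game → Game → Set where
  here : ∀ {G} → Sub G G
  viaL : ∀ {m n L R H} (i : Fin m) → Sub (L i) H → Sub (mk m n L R) H
  viaR : ∀ {m n L R H} (j : Fin n) → Sub (R j) H → Sub (mk m n L R) H

LeftEnd : Game → Set
LeftEnd G = nL G ≡ 0

RightEnd : Game → Set
RightEnd G = nR G ≡ 0

mutual
  BlockedLeftEnd : Game → Set
  BlockedLeftEnd (mk zero n L R) = (j : Fin n) → BlockedLeftEnd (R j) ⊎ SomeLeftOptBL (R j)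
  BlockedLeftEnd (mk (suc m) n L R) = ⊥

  SomeLeftOptBL : Game → Set
  SomeLeftOptBL (mk m n L R) = Σ (Fin m) (λ i → BlockedLeftEnd (L i))

mutual
  BlockedRightEnd : Game → Set
  BlockedRightEnd (mk m zero L R) = (i : Fin m) → BlockedRightEnd (L i) ⊎ SomeRightOptBR (L i)
  BlockedRightEnd (mk m (suc n) L R) = ⊥

  SomeRightOptBR : Game → Set
  SomeRightOptBR (mk m n L R) = Σ (Fin n) (λ j → BlockedRightEnd (R j))

Blocking : Game → Set
Blocking G = ∀ H → Sub G H → (LeftEnd H → BlockedLeftEnd H) × (RightEnd H → BlockedRightEnd H)

_≥B_ : Game → Game → Set
G ≥B H = ∀ X → Blocking X → o (G + X) ≥o o (H + X)

_≡B_ : Game → Game → Set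
G ≡B H = (G ≥B H) × (H ≥B G)

StrictlyPFree : Game → Set
StrictlyPFree G = ∀ H → Sub G H → ¬ (o H ≡ 𝓟)

InPB : Game → Set
InPB G = Blocking G × Σ Game (λ H → Blocking H × StrictlyPFree H × (G ≡B H))

Invertible : Game → Set
Invertible G = Blocking G × Σ Game (λ H → Blocking H × ((G + H) ≡B 𝟘))

-- T ≤ 𝓑^× : T ⊆ 𝓑^× and the ≡_𝓑-classes of elements of T form a subgroup
-- (contain the class of 0, closed under sum and inverses).
SubgroupOfUnits : (Game → Set) → Set
SubgroupOfUnits T =
  (∀ G → T G → Invertible G)
  × Σ Game (λ K → T K × (K ≡B 𝟘))
  × (∀ G H → T G → T H → Σ Game (λ K → T K × (K ≡B (G + H))))
  × (∀ G → T G → Σ Game (λ K → T K × ((G + K) ≡B 𝟘)))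

{-# OPTIONS --safe #-}
module Submission where

-- Write G ≻ X if Left wins G − X moving second. On 𝓟-free blocking games ≻ is transitive: the copycat strategy
-- fails only at ends, and there a blocked Left end E with G ≻ E forces Left to win G moving second.
-- It is also irreflexive, by induction on G: from G ≻ G one obtains an infinite ≻-increasing sequence of proper
-- subpositions of G. Hence G + H never has outcome 𝓟, as this would mean G ≻ −H ≻ G, so sums of 𝓟-free blocking
-- games are 𝓟-free. In G − G + X Left then mirrors, and when X runs out she switches to a winning first move
-- in G − G, which exists by irreflexivity.

open import Defs
open import Data.Bool using (Bool; true; false; _∨_; not)
import Data.Bool.Properties as Bool
open import Data.Empty using (⊥; ⊥-elim)
open import Data.Fin using (Fin; splitAt; _↑ˡ_; _↑ʳ_; toℕ)
open import Data.Fin.Properties using (splitAt-↑ˡ; splitAt-↑ʳ; any?; pigeonhole)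
open import Data.List using (List; _∷_; _++_; concat; tabulate; lookup)
open import Data.List.Membership.Propositional using (_∈_)
open import Data.List.Membership.Propositional.Properties using (∈-++⁺ˡ; ∈-++⁺ʳ; ∈-concat⁺′; ∈-tabulate⁺)
import Data.List.Relation.Unary.Any as Any
open import Data.List.Relation.Unary.Any.Properties using (lookup-index)
open import Data.Nat using (ℕ; zero; suc; _<′_; <′-base; ≤′-step)
open import Data.Nat.Properties using (m+n≡0⇒m≡0; m+n≡0⇒n≡0; n<1+n; <⇒<′)
open import Data.Product using (Σ; ∃; _×_; _,_; proj₁; proj₂)
open import Data.Sum using (_⊎_; inj₁; inj₂; [_,_]; [_,_]′)
open import Function using (_∘_)
open import Relation.Binary.PropositionalEquality using (_≡_; refl; sym; trans; cong; cong₂; subst)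
open import Relation.Nullary using (¬_; Dec; yes; no)
open import Relation.Nullary.Decidable using (toSum)

-- Options and winning conditions

optL : (G : Game) → Fin (nL G) → Game
optL (mk _ _ L _) = L

optR : (G : Game) → Fin (nR G) → Game
optR (mk _ _ _ R) = R

-- LF and LS: Left wins moving first, respectively second.
LF LS : Game → Set
LF G = leftFirst G ≡ true
LS G = leftSecond G ≡ true

LS? : ∀ G → Dec (LS G)
LS? G = leftSecond G Bool.≟ true

anyF⁺ : ∀ {k} (f : Fin k → Bool) i → f i ≡ true → anyF k f ≡ true
anyF⁺ f Fin.zero p rewrite p = refl
anyF⁺ f (Fin.suc i) p = trans (cong (f Fin.zero ∨_) (anyF⁺ (f ∘ Fin.suc) i p)) (Bool.∨-zeroʳ _)

anyF⁻ : ∀ {k} (f : Fin k → Bool) → anyF k f ≡ true → ∃ λ i → f i ≡ true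
anyF⁻ {suc k} f p with f Fin.zero in eq
... | true = Fin.zero , eq
... | false with i , q ← anyF⁻ (f ∘ Fin.suc) p = Fin.suc i , q

allF⁺ : ∀ {k} (f : Fin k → Bool) → (∀ i → f i ≡ true) → allF k f ≡ true
allF⁺ {zero} f p = refl
allF⁺ {suc k} f p rewrite p Fin.zero = allF⁺ (f ∘ Fin.suc) (p ∘ Fin.suc)

allF⁻ : ∀ {k} (f : Fin k → Bool) → allF k f ≡ true → ∀ i → f i ≡ true
allF⁻ {suc k} f p i with f Fin.zero in eq
allF⁻ {suc k} f p Fin.zero | true = eq
allF⁻ {suc k} f p (Fin.suc i) | true = allF⁻ (f ∘ Fin.suc) p i

anyF-not : ∀ k {f g : Fin k → Bool} → (∀ i → f i ≡ not (g i)) → anyF k f ≡ not (allF k g)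
anyF-not zero eq = refl
anyF-not (suc k) {f} {g} eq rewrite eq Fin.zero with g Fin.zero
... | true = anyF-not k (eq ∘ Fin.suc)
... | false = refl

allF-not : ∀ k {f g : Fin k → Bool} → (∀ i → f i ≡ not (g i)) → allF k f ≡ not (anyF k g)
allF-not zero eq = refl
allF-not (suc k) {f} {g} eq rewrite eq Fin.zero with g Fin.zero
... | true = refl
... | false = allF-not k (eq ∘ Fin.suc)

LF-end : ∀ G → LeftEnd G → LF G
LF-end (mk zero _ _ _) _ = refl

LF-move : ∀ G → ∃ (λ i → LS (optL G i)) → LF G
LF-move (mk (suc m) _ L _) (i , p) = anyF⁺ (leftSecond ∘ L) i p

LF-cases : ∀ G → LF G → LeftEnd G ⊎ ∃ λ i → LS (optL G i)
LF-cases (mk zero _ _ _) _ = inj₁ refl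
LF-cases (mk (suc m) _ L _) p = inj₂ (anyF⁻ (leftSecond ∘ L) p)

LS-nonend : ∀ G → LS G → ¬ RightEnd G
LS-nonend (mk _ (suc _) _ _) _ ()

LS-reply : ∀ G → LS G → ∀ j → LF (optR G j)
LS-reply (mk _ (suc n) _ R) p = allF⁻ (leftFirst ∘ R) p

LS-intro : ∀ G → ¬ RightEnd G → (∀ j → LF (optR G j)) → LS G
LS-intro (mk _ zero _ _) ne _ = ⊥-elim (ne refl)
LS-intro (mk _ (suc n) _ R) _ p = allF⁺ (leftFirst ∘ R) p

nonend⇒optL : ∀ G → ¬ LeftEnd G → Fin (nL G)
nonend⇒optL (mk zero _ _ _) ne = ⊥-elim (ne refl)
nonend⇒optL (mk (suc _) _ _ _) _ = Fin.zero

-- Sums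

module _ (P : Game → Set) where

  -- `splitAt` hides the options of a sum; an arbitrary predicate `P` keeps the index arithmetic out
  -- of later arguments.
  sumL-elim : ∀ G H → (∀ i → P (optL G i + H)) → (∀ i → P (G + optL H i)) → ∀ k → P (optL (G + H) k)
  sumL-elim (mk m _ _ _) (mk m' _ _ _) p q k with splitAt m k
  ... | inj₁ i = p i
  ... | inj₂ i = q i

  sumR-elim : ∀ G H → (∀ j → P (optR G j + H)) → (∀ j → P (G + optR H j)) → ∀ k → P (optR (G + H) k)
  sumR-elim (mk _ n _ _) (mk _ n' _ _) p q k with splitAt n k
  ... | inj₁ j = p j
  ... | inj₂ j = q j

  sumLˡ : ∀ G H i → P (optL G i + H) → ∃ λ k → P (optL (G + H) k)
  sumLˡ (mk m _ _ _) (mk m' _ _ _) i p = i ↑ˡ m' , subst (P ∘ [ _ , _ ]′) (sym (splitAt-↑ˡ m i m')) p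

  sumLʳ : ∀ G H i → P (G + optL H i) → ∃ λ k → P (optL (G + H) k)
  sumLʳ (mk m _ _ _) (mk m' _ _ _) i p = m ↑ʳ i , subst (P ∘ [ _ , _ ]′) (sym (splitAt-↑ʳ m m' i)) p

  sumRˡ : ∀ G H j → P (optR G j + H) → ∃ λ k → P (optR (G + H) k)
  sumRˡ (mk _ n _ _) (mk _ n' _ _) j p = j ↑ˡ n' , subst (P ∘ [ _ , _ ]′) (sym (splitAt-↑ˡ n j n')) p

  sumRʳ : ∀ G H j → P (G + optR H j) → ∃ λ k → P (optR (G + H) k)
  sumRʳ (mk _ n _ _) (mk _ n' _ _) j p = n ↑ʳ j , subst (P ∘ [ _ , _ ]′) (sym (splitAt-↑ʳ n n' j)) p

LeftEnd-+⁻ : ∀ G H → LeftEnd (G + H) → LeftEnd G × LeftEnd H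
LeftEnd-+⁻ (mk m _ _ _) (mk m' _ _ _) e = m+n≡0⇒m≡0 m e , m+n≡0⇒n≡0 m e

LeftEnd-+⁺ : ∀ G H → LeftEnd G → LeftEnd H → LeftEnd (G + H)
LeftEnd-+⁺ (mk zero _ _ _) (mk zero _ _ _) _ _ = refl

RightEnd-+⁻ : ∀ G H → RightEnd (G + H) → RightEnd G × RightEnd H
RightEnd-+⁻ (mk _ n _ _) (mk _ n' _ _) e = m+n≡0⇒m≡0 n e , m+n≡0⇒n≡0 n e

Sub-trans : ∀ {G H K} → Sub G H → Sub H K → Sub G K
Sub-trans here t = t
Sub-trans (viaL i s) t = viaL i (Sub-trans s t)
Sub-trans (viaR j s) t = viaR j (Sub-trans s t)

Sub-optL : ∀ G i → Sub G (optL G i)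
Sub-optL (mk _ _ _ _) i = viaL i here

Sub-optR : ∀ G j → Sub G (optR G j)
Sub-optR (mk _ _ _ _) j = viaR j here

-- Phrased as an elimination because a position reached from `G + H` reduces to a sum only after a
-- case split on each move.
Sub-+ : ∀ G H (P : Game → Set) → (∀ {G' H'} → Sub G G' → Sub H H' → P (G' + H')) → ∀ {K} → Sub (G + H) K → P K
Sub-+ (mk _ _ _ _) (mk _ _ _ _) P p here = p here here
Sub-+ G@(mk _ _ L _) H@(mk _ _ L' _) P p {K} (viaL k s) =
  sumL-elim (λ Z → Sub Z K → P K) G H
    (λ i → Sub-+ (L i) H P (p ∘ viaL i))
    (λ i → Sub-+ G (L' i) P (λ s t → p s (viaL i t))) k s
Sub-+ G@(mk _ _ _ R) H@(mk _ _ _ R') P p {K} (viaR k s) =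
  sumR-elim (λ Z → Sub Z K → P K) G H
    (λ j → Sub-+ (R j) H P (p ∘ viaR j))
    (λ j → Sub-+ G (R' j) P (λ s t → p s (viaR j t))) k s

-- Game forms up to reordering and repetition of options

data _≅_ (G H : Game) : Set where
  bisim : (∀ i → ∃ λ i' → optL G i ≅ optL H i') → (∀ i' → ∃ λ i → optL G i ≅ optL H i') →
          (∀ j → ∃ λ j' → optR G j ≅ optR H j') → (∀ j' → ∃ λ j → optR G j ≅ optR H j') → G ≅ H

infix 4 _≅_

_≅ᴸ_ _ᴸ≅_ _≅ᴿ_ _ᴿ≅_ : Game → Game → Set
K ≅ᴸ H = ∃ λ i → K ≅ optL H i
G ᴸ≅ K = ∃ λ i → optL G i ≅ K
K ≅ᴿ H = ∃ λ j → K ≅ optR H j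
G ᴿ≅ K = ∃ λ j → optR G j ≅ K

infix 4 _≅ᴸ_ _ᴸ≅_ _≅ᴿ_ _ᴿ≅_

≅-refl : ∀ {G} → G ≅ G
≅-refl {mk _ _ L R} = bisim (λ i → i , ≅-refl {L i}) (λ i → i , ≅-refl {L i}) (λ j → j , ≅-refl {R j}) (λ j → j , ≅-refl {R j})

≅-sym : ∀ {G H} → G ≅ H → H ≅ G
≅-sym (bisim a b c d) =
  bisim (λ i → let i' , p = b i in i' , ≅-sym p) (λ i → let i' , p = a i in i' , ≅-sym p)
        (λ j → let j' , p = d j in j' , ≅-sym p) (λ j → let j' , p = c j in j' , ≅-sym p)

≅-trans : ∀ {G H K} → G ≅ H → H ≅ K → G ≅ K
≅-trans (bisim a b c d) (bisim a' b' c' d') =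
  bisim (λ i → let i' , p = a i ; i'' , q = a' i' in i'' , ≅-trans p q)
        (λ i → let i' , p = b' i ; i'' , q = b i' in i'' , ≅-trans q p)
        (λ j → let j' , p = c j ; j'' , q = c' j' in j'' , ≅-trans p q)
        (λ j → let j' , p = d' j ; j'' , q = d j' in j'' , ≅-trans q p)

Fin0-empty : ∀ {m} → m ≡ 0 → ¬ Fin m
Fin0-empty refl ()

empty⇒0 : ∀ {m} → ¬ Fin m → m ≡ 0
empty⇒0 {zero} _ = refl
empty⇒0 {suc m} e = ⊥-elim (e Fin.zero)

mutual
  ≅-LF : ∀ {G H} → G ≅ H → LF G → LF H
  ≅-LF {G} {H} (bisim a b _ _) p with LF-cases G p
  ... | inj₁ e = LF-end H (empty⇒0 (Fin0-empty e ∘ proj₁ ∘ b))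
  ... | inj₂ (i , q) = LF-move H (let i' , r = a i in i' , ≅-LS r q)

  ≅-LS : ∀ {G H} → G ≅ H → LS G → LS H
  ≅-LS {G} {H} (bisim _ _ c d) p =
    LS-intro H (λ e → LS-nonend G p (empty⇒0 (Fin0-empty e ∘ proj₁ ∘ c)))
      (λ j → let j' , r = d j in ≅-LF r (LS-reply G p j'))

bool-ext : ∀ {a b} → (a ≡ true → b ≡ true) → (b ≡ true → a ≡ true) → a ≡ b
bool-ext {true} f _ = sym (f refl)
bool-ext {false} {true} _ g = g refl
bool-ext {false} {false} _ _ = refl

≅-o : ∀ {G H} → G ≅ H → o G ≡ o H
≅-o p = cong₂ outcomeOf (bool-ext (≅-LF p) (≅-LF (≅-sym p))) (bool-ext (≅-LS p) (≅-LS (≅-sym p)))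

+-cong : ∀ {G G' H H'} → G ≅ G' → H ≅ H' → G + H ≅ G' + H'
+-cong {G} {G'} {H} {H'} p@(bisim a b c d) q@(bisim a' b' c' d') = bisim
  (sumL-elim (_≅ᴸ G' + H') G H
    (λ i → let i' , r = a i in sumLˡ (_ ≅_) G' H' i' (+-cong r q))
    (λ i → let i' , r = a' i in sumLʳ (_ ≅_) G' H' i' (+-cong p r)))
  (sumL-elim (G + H ᴸ≅_) G' H'
    (λ i → let i' , r = b i in sumLˡ (_≅ _) G H i' (+-cong r q))
    (λ i → let i' , r = b' i in sumLʳ (_≅ _) G H i' (+-cong p r)))
  (sumR-elim (_≅ᴿ G' + H') G H
    (λ j → let j' , r = c j in sumRˡ (_ ≅_) G' H' j' (+-cong r q))
    (λ j → let j' , r = c' j in sumRʳ (_ ≅_) G' H' j' (+-cong p r)))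
  (sumR-elim (G + H ᴿ≅_) G' H'
    (λ j → let j' , r = d j in sumRˡ (_≅ _) G H j' (+-cong r q))
    (λ j → let j' , r = d' j in sumRʳ (_≅ _) G H j' (+-cong p r)))

+-comm : ∀ G H → G + H ≅ H + G
+-comm G@(mk _ _ L R) H@(mk _ _ L' R') = bisim
  (sumL-elim (_≅ᴸ H + G) G H
    (λ i → sumLʳ (_ ≅_) H G i (+-comm (L i) H))
    (λ i → sumLˡ (_ ≅_) H G i (+-comm G (L' i))))
  (sumL-elim (G + H ᴸ≅_) H G
    (λ i → sumLʳ (_≅ _) G H i (+-comm G (L' i)))
    (λ i → sumLˡ (_≅ _) G H i (+-comm (L i) H)))
  (sumR-elim (_≅ᴿ H + G) G H
    (λ j → sumRʳ (_ ≅_) H G j (+-comm (R j) H))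
    (λ j → sumRˡ (_ ≅_) H G j (+-comm G (R' j))))
  (sumR-elim (G + H ᴿ≅_) H G
    (λ j → sumRʳ (_≅ _) G H j (+-comm G (R' j)))
    (λ j → sumRˡ (_≅ _) G H j (+-comm (R j) H)))

+-assoc : ∀ G H K → (G + H) + K ≅ G + (H + K)
+-assoc G@(mk _ _ L R) H@(mk _ _ L' R') K@(mk _ _ L'' R'') = bisim
  (sumL-elim (_≅ᴸ G + (H + K)) (G + H) K
    (sumL-elim (λ Z → Z + K ≅ᴸ G + (H + K)) G H
      (λ i → sumLˡ (_ ≅_) G (H + K) i (+-assoc (L i) H K))
      (λ i → inLʳ (_ ≅_) (sumLˡ (λ Z → _ ≅ G + Z) H K i (+-assoc G (L' i) K))))
    (λ i → inLʳ (_ ≅_) (sumLʳ (λ Z → _ ≅ G + Z) H K i (+-assoc G H (L'' i)))))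
  (sumL-elim (G + H + K ᴸ≅_) G (H + K)
    (λ i → inLˡ (_≅ _) (sumLˡ (λ Z → Z + K ≅ _) G H i (+-assoc (L i) H K)))
    (sumL-elim (λ Z → G + H + K ᴸ≅ G + Z) H K
      (λ i → inLˡ (_≅ _) (sumLʳ (λ Z → Z + K ≅ _) G H i (+-assoc G (L' i) K)))
      (λ i → sumLʳ (_≅ _) (G + H) K i (+-assoc G H (L'' i)))))
  (sumR-elim (_≅ᴿ G + (H + K)) (G + H) K
    (sumR-elim (λ Z → Z + K ≅ᴿ G + (H + K)) G H
      (λ j → sumRˡ (_ ≅_) G (H + K) j (+-assoc (R j) H K))
      (λ j → inRʳ (_ ≅_) (sumRˡ (λ Z → _ ≅ G + Z) H K j (+-assoc G (R' j) K))))
    (λ j → inRʳ (_ ≅_) (sumRʳ (λ Z → _ ≅ G + Z) H K j (+-assoc G H (R'' j)))))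
  (sumR-elim (G + H + K ᴿ≅_) G (H + K)
    (λ j → inRˡ (_≅ _) (sumRˡ (λ Z → Z + K ≅ _) G H j (+-assoc (R j) H K)))
    (sumR-elim (λ Z → G + H + K ᴿ≅ G + Z) H K
      (λ j → inRˡ (_≅ _) (sumRʳ (λ Z → Z + K ≅ _) G H j (+-assoc G (R' j) K)))
      (λ j → sumRʳ (_≅ _) (G + H) K j (+-assoc G H (R'' j)))))
  where
  inLʳ : ∀ P → ∃ (λ i → P (G + optL (H + K) i)) → ∃ λ k → P (optL (G + (H + K)) k)
  inLʳ P (i , p) = sumLʳ P G (H + K) i p
  inLˡ : ∀ P → ∃ (λ i → P (optL (G + H) i + K)) → ∃ λ k → P (optL (G + H + K) k)
  inLˡ P (i , p) = sumLˡ P (G + H) K i p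
  inRʳ : ∀ P → ∃ (λ j → P (G + optR (H + K) j)) → ∃ λ k → P (optR (G + (H + K)) k)
  inRʳ P (j , p) = sumRʳ P G (H + K) j p
  inRˡ : ∀ P → ∃ (λ j → P (optR (G + H) j + K)) → ∃ λ k → P (optR (G + H + K) k)
  inRˡ P (j , p) = sumRˡ P (G + H) K j p

+-identityˡ : ∀ G → 𝟘 + G ≅ G
+-identityˡ G@(mk _ _ L R) = bisim
  (λ i → i , +-identityˡ (L i)) (λ i → i , +-identityˡ (L i))
  (λ j → j , +-identityˡ (R j)) (λ j → j , +-identityˡ (R j))

-- Conjugation

conj : Game → Game
conj (mk m n L R) = mk n m (λ j → conj (R j)) (λ i → conj (L i))

conj-involutive : ∀ G → conj (conj G) ≅ G
conj-involutive (mk _ _ L R) = bisim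
  (λ i → i , conj-involutive (L i)) (λ i → i , conj-involutive (L i))
  (λ j → j , conj-involutive (R j)) (λ j → j , conj-involutive (R j))

conj-+ : ∀ G H → conj (G + H) ≅ conj G + conj H
conj-+ G@(mk _ _ L R) H@(mk _ _ L' R') = bisim
  (sumR-elim (λ Z → conj Z ≅ᴸ conj G + conj H) G H
    (λ j → sumLˡ (_ ≅_) (conj G) (conj H) j (conj-+ (R j) H))
    (λ j → sumLʳ (_ ≅_) (conj G) (conj H) j (conj-+ G (R' j))))
  (sumL-elim (conj (G + H) ᴸ≅_) (conj G) (conj H)
    (λ j → sumRˡ (λ Z → conj Z ≅ _) G H j (conj-+ (R j) H))
    (λ j → sumRʳ (λ Z → conj Z ≅ _) G H j (conj-+ G (R' j))))
  (sumL-elim (λ Z → conj Z ≅ᴿ conj G + conj H) G H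
    (λ i → sumRˡ (_ ≅_) (conj G) (conj H) i (conj-+ (L i) H))
    (λ i → sumRʳ (_ ≅_) (conj G) (conj H) i (conj-+ G (L' i))))
  (sumR-elim (conj (G + H) ᴿ≅_) (conj G) (conj H)
    (λ i → sumLˡ (λ Z → conj Z ≅ _) G H i (conj-+ (L i) H))
    (λ i → sumLʳ (λ Z → conj Z ≅ _) G H i (conj-+ G (L' i))))

mutual
  -- A player without a move wins, so the base cases match; elsewhere negation exchanges `anyF` and
  -- `allF`.
  leftFirst-conj : ∀ G → leftFirst (conj G) ≡ not (leftSecond G)
  leftFirst-conj (mk _ zero _ _) = refl
  leftFirst-conj (mk _ (suc n) _ R) = anyF-not (suc n) (λ j → leftSecond-conj (R j))

  leftSecond-conj : ∀ G → leftSecond (conj G) ≡ not (leftFirst G)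
  leftSecond-conj (mk zero _ _ _) = refl
  leftSecond-conj (mk (suc m) _ L _) = allF-not (suc m) (λ i → leftFirst-conj (L i))

¬LS⇒LF-conj : ∀ G → ¬ LS G → LF (conj G)
¬LS⇒LF-conj G ¬p = trans (leftFirst-conj G) (cong not (Bool.¬-not ¬p))

LF-conj⇒¬LS : ∀ G → LF (conj G) → ¬ LS G
LF-conj⇒¬LS G p q with () ← trans (sym p) (trans (leftFirst-conj G) (cong not q))

¬LF⇒LS-conj : ∀ G → ¬ LF G → LS (conj G)
¬LF⇒LS-conj G ¬p = trans (leftSecond-conj G) (cong not (Bool.¬-not ¬p))

LS-conj⇒¬LF : ∀ G → LS (conj G) → ¬ LF G
LS-conj⇒¬LF G p q with () ← trans (sym p) (trans (leftSecond-conj G) (cong not q))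

Sub-conj : ∀ G (P : Game → Set) → (∀ {H} → Sub G H → P (conj H)) → ∀ {K} → Sub (conj G) K → P K
Sub-conj (mk _ _ _ _) P p here = p here
Sub-conj (mk _ _ _ R) P p (viaL j s) = Sub-conj (R j) P (p ∘ viaR j) s
Sub-conj (mk _ _ L _) P p (viaR i s) = Sub-conj (L i) P (p ∘ viaL i) s

-- Blocking and 𝓟-free games

BlockedLeftEnd⇒LeftEnd : ∀ G → BlockedLeftEnd G → LeftEnd G
BlockedLeftEnd⇒LeftEnd (mk zero _ _ _) _ = refl

mutual
  BlockedLeftEnd-conj : ∀ G → BlockedLeftEnd G → BlockedRightEnd (conj G)
  BlockedLeftEnd-conj (mk zero _ _ R) b j with b j
  ... | inj₁ p = inj₁ (BlockedLeftEnd-conj (R j) p)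
  ... | inj₂ p = inj₂ (SomeLeftOptBL-conj (R j) p)

  SomeLeftOptBL-conj : ∀ G → SomeLeftOptBL G → SomeRightOptBR (conj G)
  SomeLeftOptBL-conj (mk _ _ L _) (i , p) = i , BlockedLeftEnd-conj (L i) p

mutual
  BlockedRightEnd-conj : ∀ G → BlockedRightEnd G → BlockedLeftEnd (conj G)
  BlockedRightEnd-conj (mk _ zero L _) b i with b i
  ... | inj₁ p = inj₁ (BlockedRightEnd-conj (L i) p)
  ... | inj₂ p = inj₂ (SomeRightOptBR-conj (L i) p)

  SomeRightOptBR-conj : ∀ G → SomeRightOptBR G → SomeLeftOptBL (conj G)
  SomeRightOptBR-conj (mk _ _ _ R) (j , p) = j , BlockedRightEnd-conj (R j) p

LeftEnd-conj⁻ : ∀ G → LeftEnd (conj G) → RightEnd G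
LeftEnd-conj⁻ (mk _ _ _ _) e = e

RightEnd-conj⁻ : ∀ G → RightEnd (conj G) → LeftEnd G
RightEnd-conj⁻ (mk _ _ _ _) e = e

Blocking-conj : ∀ G → Blocking G → Blocking (conj G)
Blocking-conj G b K = Sub-conj G (λ K → (LeftEnd K → BlockedLeftEnd K) × (RightEnd K → BlockedRightEnd K))
  (λ {H} s → BlockedRightEnd-conj H ∘ proj₂ (b H s) ∘ LeftEnd-conj⁻ H ,
             BlockedLeftEnd-conj H ∘ proj₁ (b H s) ∘ RightEnd-conj⁻ H)

BlockedLeftEnd-intro : ∀ G → LeftEnd G → (∀ j → BlockedLeftEnd (optR G j) ⊎ SomeLeftOptBL (optR G j)) → BlockedLeftEnd G
BlockedLeftEnd-intro (mk zero _ _ _) _ p = p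

SomeLeftOptBL-intro : ∀ G → ∃ (λ i → BlockedLeftEnd (optL G i)) → SomeLeftOptBL G
SomeLeftOptBL-intro (mk _ _ _ _) p = p

mutual
  -- A Right move in one summand is answered, if at all, in that summand, while the other remains a
  -- blocked Left end.
  BlockedLeftEnd-+ : ∀ G H → BlockedLeftEnd G → BlockedLeftEnd H → BlockedLeftEnd (G + H)
  BlockedLeftEnd-+ G@(mk zero _ _ R) H@(mk zero _ _ R') b b' =
    BlockedLeftEnd-intro (G + H) refl
      (sumR-elim (λ Z → BlockedLeftEnd Z ⊎ SomeLeftOptBL Z) G H
        (λ j → [ (λ p → inj₁ (BlockedLeftEnd-+ (R j) H p b')) , (λ p → inj₂ (SomeLeftOptBL-+ˡ (R j) H p b')) ] (b j))
        (λ j → [ (λ p → inj₁ (BlockedLeftEnd-+ G (R' j) b p)) , (λ p → inj₂ (SomeLeftOptBL-+ʳ G (R' j) b p)) ] (b' j)))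

  SomeLeftOptBL-+ˡ : ∀ G H → SomeLeftOptBL G → BlockedLeftEnd H → SomeLeftOptBL (G + H)
  SomeLeftOptBL-+ˡ G@(mk _ _ L _) H (i , p) b =
    SomeLeftOptBL-intro (G + H) (sumLˡ BlockedLeftEnd G H i (BlockedLeftEnd-+ (L i) H p b))

  SomeLeftOptBL-+ʳ : ∀ G H → BlockedLeftEnd G → SomeLeftOptBL H → SomeLeftOptBL (G + H)
  SomeLeftOptBL-+ʳ G H@(mk _ _ L _) b (i , p) =
    SomeLeftOptBL-intro (G + H) (sumLʳ BlockedLeftEnd G H i (BlockedLeftEnd-+ G (L i) b p))

BlockedRightEnd-intro : ∀ G → RightEnd G → (∀ i → BlockedRightEnd (optL G i) ⊎ SomeRightOptBR (optL G i)) → BlockedRightEnd G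
BlockedRightEnd-intro (mk _ zero _ _) _ p = p

SomeRightOptBR-intro : ∀ G → ∃ (λ j → BlockedRightEnd (optR G j)) → SomeRightOptBR G
SomeRightOptBR-intro (mk _ _ _ _) p = p

mutual
  BlockedRightEnd-+ : ∀ G H → BlockedRightEnd G → BlockedRightEnd H → BlockedRightEnd (G + H)
  BlockedRightEnd-+ G@(mk _ zero L _) H@(mk _ zero L' _) b b' =
    BlockedRightEnd-intro (G + H) refl
      (sumL-elim (λ Z → BlockedRightEnd Z ⊎ SomeRightOptBR Z) G H
        (λ i → [ (λ p → inj₁ (BlockedRightEnd-+ (L i) H p b')) , (λ p → inj₂ (SomeRightOptBR-+ˡ (L i) H p b')) ] (b i))
        (λ i → [ (λ p → inj₁ (BlockedRightEnd-+ G (L' i) b p)) , (λ p → inj₂ (SomeRightOptBR-+ʳ G (L' i) b p)) ] (b' i)))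

  SomeRightOptBR-+ˡ : ∀ G H → SomeRightOptBR G → BlockedRightEnd H → SomeRightOptBR (G + H)
  SomeRightOptBR-+ˡ G@(mk _ _ _ R) H (j , p) b =
    SomeRightOptBR-intro (G + H) (sumRˡ BlockedRightEnd G H j (BlockedRightEnd-+ (R j) H p b))

  SomeRightOptBR-+ʳ : ∀ G H → BlockedRightEnd G → SomeRightOptBR H → SomeRightOptBR (G + H)
  SomeRightOptBR-+ʳ G H@(mk _ _ _ R) b (j , p) =
    SomeRightOptBR-intro (G + H) (sumRʳ BlockedRightEnd G H j (BlockedRightEnd-+ G (R j) b p))

Blocking-+ : ∀ G H → Blocking G → Blocking H → Blocking (G + H)
Blocking-+ G H b c K = Sub-+ G H (λ K → (LeftEnd K → BlockedLeftEnd K) × (RightEnd K → BlockedRightEnd K))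
  (λ {G'} {H'} s t →
    (λ e → let e₁ , e₂ = LeftEnd-+⁻ G' H' e in BlockedLeftEnd-+ G' H' (proj₁ (b G' s) e₁) (proj₁ (c H' t) e₂)) ,
    (λ e → let e₁ , e₂ = RightEnd-+⁻ G' H' e in BlockedRightEnd-+ G' H' (proj₂ (b G' s) e₁) (proj₂ (c H' t) e₂)))

-- Outcome 𝓟 is excluded in the form of an implication, which lets Left trade a win moving second
-- for a win moving first.
PFree : Game → Set
PFree G = ∀ {H} → Sub G H → LS H → LF H

-- Conjugation negates and exchanges the two winning conditions, so the implication becomes its
-- contrapositive.
PFree-conj : ∀ G → PFree G → PFree (conj G)
PFree-conj G pf = Sub-conj G (λ K → LS K → LF K)
  (λ {H} s p → ¬LS⇒LF-conj H (LS-conj⇒¬LF H p ∘ pf s))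

-- A blocked Left end does not hurt Left: every Right move in it is either harmless or can be answered in it.
mutual
  blocked-LS : ∀ H X → PFree H → BlockedLeftEnd X → LS H → LS (H + X)
  blocked-LS H@(mk _ _ _ R') X@(mk zero _ _ R) pf b p =
    LS-intro (H + X) (LS-nonend H p ∘ proj₁ ∘ RightEnd-+⁻ H X)
      (sumR-elim LF H X
        (λ j → blocked-LF (R' j) X (pf ∘ viaR j) b (LS-reply H p j))
        -- If Right's move leaves a blocked Left end, Left is now first in `H`, where she wins by
        -- 𝓟-freeness; otherwise she answers in `X` and stays second in `H`.
        (λ j → [ (λ c → blocked-LF H (R j) pf c (pf here p)) , (λ c → blocked-reply H (R j) pf c p) ] (b j)))

  blocked-LF : ∀ H X → PFree H → BlockedLeftEnd X → LF H → LF (H + X)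
  blocked-LF H@(mk _ _ L _) X pf b p with LF-cases H p
  ... | inj₁ e = LF-end (H + X) (LeftEnd-+⁺ H X e (BlockedLeftEnd⇒LeftEnd X b))
  ... | inj₂ (i , q) = LF-move (H + X) (sumLˡ LS H X i (blocked-LS (L i) X (pf ∘ viaL i) b q))

  blocked-reply : ∀ H X → PFree H → SomeLeftOptBL X → LS H → LF (H + X)
  blocked-reply H X@(mk _ _ L _) pf (i , b) p = LF-move (H + X) (sumLʳ LS H X i (blocked-LS H (L i) pf b p))

-- The comparison ≻ and its transitivity

Nice : Game → Set
Nice G = Blocking G × PFree G

Nice-Sub : ∀ {G H} → Nice G → Sub G H → Nice H
Nice-Sub (b , pf) s = (λ K t → b K (Sub-trans s t)) , (λ t → pf (Sub-trans s t))

Nice-conj : ∀ G → Nice G → Nice (conj G)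
Nice-conj G (b , pf) = Blocking-conj G b , PFree-conj G pf

-- G ≻ X and G ⊳ X: Left wins G − X moving second, respectively first.
_≻_ _⊳_ : Game → Game → Set
G ≻ X = LS (G + conj X)
G ⊳ X = LF (G + conj X)

infix 4 _≻_ _⊳_

_≻?_ : ∀ G X → Dec (G ≻ X)
G ≻? X = LS? (G + conj X)

⊳-moveˡ : ∀ G X i → optL G i ≻ X → G ⊳ X
⊳-moveˡ G X i p = LF-move (G + conj X) (sumLˡ LS G (conj X) i p)

⊳-moveʳ : ∀ G X j → G ≻ optR X j → G ⊳ X
⊳-moveʳ G X@(mk _ _ _ _) j p = LF-move (G + conj X) (sumLʳ LS G (conj X) j p)

-- Left's moves in `conj X` are Right's moves in `X`; the first continuation covers a Left without
-- any move, who wins.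
⊳-elim : ∀ {Z : Set} G X → (LeftEnd G → RightEnd X → Z) → (∀ i → optL G i ≻ X → Z) → (∀ j → G ≻ optR X j → Z) →
         G ⊳ X → Z
⊳-elim {Z} G X@(mk _ _ _ _) f g h p with LF-cases (G + conj X) p
... | inj₁ e = let e₁ , e₂ = LeftEnd-+⁻ G (conj X) e in f e₁ e₂
... | inj₂ (k , q) = sumL-elim (λ K → LS K → Z) G (conj X) g h k q

≻-intro : ∀ G X → ¬ (RightEnd G × LeftEnd X) → (∀ j → optR G j ⊳ X) → (∀ i → G ⊳ optL X i) → G ≻ X
≻-intro G X@(mk _ _ _ _) ne p q = LS-intro (G + conj X) (ne ∘ RightEnd-+⁻ G (conj X)) (sumR-elim LF G (conj X) p q)

≻-replyˡ : ∀ G X → G ≻ X → ∀ j → optR G j ⊳ X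
-- Using an implication out of `LF Z` as the predicate, proved by the identity, yields the index `k`
-- together with a transport back from option `k`.
≻-replyˡ G X p j = let k , q = sumRˡ (λ Z → LF Z → optR G j ⊳ X) G (conj X) j (λ z → z) in q (LS-reply (G + conj X) p k)

≻-replyʳ : ∀ G X → G ≻ X → ∀ i → G ⊳ optL X i
≻-replyʳ G X@(mk _ _ L _) p i =
  let k , q = sumRʳ (λ Z → LF Z → G ⊳ L i) G (conj X) i (λ z → z) in q (LS-reply (G + conj X) p k)

conj-diff : ∀ G X → conj (G + conj X) ≅ X + conj G
conj-diff G X = ≅-trans (conj-+ G (conj X)) (≅-trans (+-cong ≅-refl (conj-involutive X)) (+-comm (conj G) X))

-- Determinacy of play, as X - G is the conjugate of G - X.
¬≻⇒⊳ : ∀ G X → ¬ G ≻ X → X ⊳ G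
¬≻⇒⊳ G X ¬p = ≅-LF (conj-diff G X) (¬LS⇒LF-conj (G + conj X) ¬p)

⊳⇒¬≻ : ∀ G X → X ⊳ G → ¬ G ≻ X
⊳⇒¬≻ G X p = LF-conj⇒¬LS (G + conj X) (≅-LF (≅-sym (conj-diff G X)) p)

-- Otherwise Left wins -G moving first; the blocked Left end `Q` does not spoil this, so she wins Q
-- - G moving first, against `G ≻ Q`.
LeftEnd⇒LS : ∀ {G Q} → Nice G → Nice Q → LeftEnd Q → G ≻ Q → LS G
LeftEnd⇒LS {G} {Q} (_ , pf) (b , _) e p with LS? G
... | yes q = q
... | no ¬q = ⊥-elim (⊳⇒¬≻ G Q
  (≅-LF (+-comm (conj G) Q)
    (blocked-LF (conj G) Q (PFree-conj G pf) (proj₁ (b Q here) e) (¬LS⇒LF-conj G ¬q))) p)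

RightEnd⇒¬LF : ∀ {G Q} → Nice G → Nice Q → RightEnd Q → Q ≻ G → ¬ LF G
RightEnd⇒¬LF {G} {Q} (_ , pf) (b , _) e p q =
  ⊳⇒¬≻ Q G (blocked-LF G (conj Q) pf (BlockedRightEnd-conj Q (proj₂ (b Q here) e)) q) p

mutual
  -- Left follows her strategies for A - B and B - C. An answer that falls in `B` is a move of Right
  -- for the other strategy, and this continues until an answer falls in `A` or `C`. Positions where
  -- a strategy has no move left are treated separately.
  ≻-trans : ∀ A B C → Nice A → Nice B → Nice C → A ≻ B → B ≻ C → A ≻ C
  ≻-trans A@(mk _ _ _ R) B C@(mk _ _ L _) a b c p q = ≻-intro A C
    -- If Right could not move in A - C, the end `C` would make Left win `B` moving second, hence
    -- first, while the end `A` forbids the latter.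
    (λ (e , f) → RightEnd⇒¬LF b a e p (proj₂ b here (LeftEnd⇒LS b c f q)))
    (λ j → ⊳-≻-trans (R j) B C (Nice-Sub a (viaR j here)) b c (≻-replyˡ A B p j) q)
    (λ i → ≻-⊳-trans A B (L i) a b (Nice-Sub c (viaL i here)) p (≻-replyʳ B C q i))

  ⊳-≻-trans : ∀ A B C → Nice A → Nice B → Nice C → A ⊳ B → B ≻ C → A ⊳ C
  ⊳-≻-trans A@(mk _ _ L _) B@(mk _ _ _ R) C a b c p q = ⊳-elim A B
    -- The strategy for A - B has run out. Since `B` is a Right end, Left does not win `C` moving
    -- first, so she wins -C moving second and hence first; the blocked Left end `A` is harmless.
    (λ e f → ≅-LF (+-comm (conj C) A)
      (blocked-LF (conj C) A (PFree-conj C (proj₂ c)) (proj₁ (proj₁ a A here) e)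
        (PFree-conj C (proj₂ c) here (¬LF⇒LS-conj C (RightEnd⇒¬LF c b f q)))))
    (λ i r → ⊳-moveˡ A C i (≻-trans (L i) B C (Nice-Sub a (viaL i here)) b c r q))
    (λ j r → ≻-⊳-trans A (R j) C a (Nice-Sub b (viaR j here)) c r (≻-replyˡ B C q j))
    p

  ≻-⊳-trans : ∀ A B C → Nice A → Nice B → Nice C → A ≻ B → B ⊳ C → A ⊳ C
  ≻-⊳-trans A B@(mk _ _ L _) C@(mk _ _ _ R) a b c p q = ⊳-elim B C
    (λ e f → blocked-LF A (conj C) (proj₂ a) (BlockedRightEnd-conj C (proj₂ (proj₁ c C here) f))
      (proj₂ a here (LeftEnd⇒LS a b e p)))
    (λ i r → ⊳-≻-trans A (L i) C a (Nice-Sub b (viaL i here)) c (≻-replyʳ A B p i) r)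
    (λ j r → ⊳-moveʳ A C j (≻-trans A B (R j) a b (Nice-Sub c (viaR j here)) p r))
    q

-- Irreflexivity of ≻

subs : Game → List Game
subs (mk m n L R) = mk m n L R ∷ concat (tabulate (λ i → subs (L i))) ++ concat (tabulate (λ j → subs (R j)))

Sub⇒∈subs : ∀ {G H} → Sub G H → H ∈ subs G
Sub⇒∈subs {mk _ _ _ _} here = Any.here refl
Sub⇒∈subs (viaL i s) = Any.there (∈-++⁺ˡ (∈-concat⁺′ (Sub⇒∈subs s) (∈-tabulate⁺ i)))
Sub⇒∈subs {mk m _ L _} (viaR j s) =
  Any.there (∈-++⁺ʳ (concat (tabulate (λ i → subs (L i)))) (∈-concat⁺′ (Sub⇒∈subs s) (∈-tabulate⁺ j)))

-- If G ≻ G and Left does not win G moving second, then every terminal position is exceeded by another one: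
-- some G^L beats it, and Left keeps beating it by answering Right's moves to positions below G.
module NoSelfDomination (G : Game) (nice : Nice G) (¬LSG : ¬ LS G) (G≻G : G ≻ G)
  (irr : ∀ i {M} → Sub (optL G i) M → ¬ M ≻ M) where

  -- By `closed`, Left's winning first move in G - `pos` cannot be made in -`pos`. The fields `root`
  -- and `sub` make `pos` a proper subposition, within reach of `irr`.
  record Terminal : Set where
    constructor terminal
    field
      pos    : Game
      root   : Fin (nL G)
      sub    : Sub (optL G root) pos
      above  : G ⊳ pos
      closed : ∀ j → ¬ G ≻ optR pos j

    sub′ : Sub G pos
    sub′ = Sub-trans (Sub-optL G root) sub

  open Terminal

  below-nonend : ∀ {Q} → Sub G Q → G ≻ Q → ¬ LeftEnd Q
  below-nonend s p e = ¬LSG (LeftEnd⇒LS nice (Nice-Sub nice s) e p)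

  mutual
    -- While `G` beats some Right option Q of `M`, Q is not a Left end, and any Left option of Q can
    -- replace `M`. Positions shrink, so this stops.
    start : ∀ i M → Sub (optL G i) M → G ⊳ M → Terminal
    start i M@(mk _ _ _ R) s p =
      [ (λ (j , q) → start-reply i (R j) (Sub-trans s (viaR j here)) q)
      , (λ ¬q → terminal M i s p (λ j q → ¬q (j , q))) ]′ (toSum (any? (λ j → G ≻? R j)))

    start-reply : ∀ i Q → Sub (optL G i) Q → G ≻ Q → Terminal
    start-reply i Q@(mk _ _ L _) s p = start i (L k) (Sub-trans s (viaL k here)) (≻-replyʳ G Q p k)
      where k = nonend⇒optL Q (below-nonend (Sub-trans (Sub-optL G i) s) p)

  module _ (T : Terminal) where

    mutual
      -- The descent of `start`, with the Left option of Q now chosen by Left's strategy against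
      -- `pos T` so that the comparison with `pos T` is kept.
      climb : ∀ i M → Sub (optL G i) M → G ⊳ M → M ≻ pos T → ∃ λ T′ → pos T′ ≻ pos T
      climb i M@(mk _ _ _ R) s p r =
        [ (λ (j , q) → climb-reply i (R j) (Sub-trans s (viaR j here)) q (≻-replyˡ M (pos T) r j))
        , (λ ¬q → terminal M i s p (λ j q → ¬q (j , q)) , r) ]′ (toSum (any? (λ j → G ≻? R j)))

      climb-reply : ∀ i Q → Sub (optL G i) Q → G ≻ Q → Q ⊳ pos T → ∃ λ T′ → pos T′ ≻ pos T
      climb-reply i Q@(mk _ _ L _) s p = ⊳-elim Q (pos T)
        (λ e _ → ⊥-elim (below-nonend s′ p e))
        (λ k r → climb i (L k) (Sub-trans s (viaL k here)) (≻-replyʳ G Q p k) r)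
        -- An answer in -`pos T` would give G ≻ Q ≻ a Right option of `pos T`, contrary to `closed`.
        (λ j r → ⊥-elim (closed T j (≻-trans G Q (optR (pos T) j) nice (Nice-Sub nice s′)
                   (Nice-Sub nice (Sub-trans (sub′ T) (Sub-optR (pos T) j))) p r)))
        where s′ = Sub-trans (Sub-optL G i) s

    -- Left's winning first move in G - `pos T` leads to some G^L ≻ `pos T`; since `G ≻ G` also
    -- gives G ⊳ G^L, the climb starts there.
    next : ∃ λ T′ → pos T′ ≻ pos T
    next = ⊳-elim G (pos T)
      (λ e _ → ⊥-elim (below-nonend here G≻G e))
      (λ i r → climb i (optL G i) here (≻-replyʳ G G G≻G i) r)
      (λ j r → ⊥-elim (closed T j r))
      (above T)

  chain : ℕ → Terminal
  chain zero = start i (optL G i) here (≻-replyʳ G G G≻G i)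
    where i = nonend⇒optL G (below-nonend here G≻G)
  chain (suc n) = proj₁ (next (chain n))

  chain-increasing : ∀ {m n} → m <′ n → pos (chain n) ≻ pos (chain m)
  chain-increasing {m} <′-base = proj₂ (next (chain m))
  chain-increasing {m} (≤′-step {n} m<n) =
    ≻-trans _ (pos (chain n)) _ (nice′ (suc n)) (nice′ n) (nice′ m) (proj₂ (next (chain n))) (chain-increasing m<n)
    where
    nice′ : ∀ k → Nice (pos (chain k))
    nice′ k = Nice-Sub nice (sub′ (chain k))

  contradiction : ⊥
  contradiction =
    -- One more link of the chain than entries in `subs G`: two links are the same game, which then
    -- beats itself.
    let a , b , a<b , eq = pigeonhole (n<1+n _) (λ a → Any.index (mem (toℕ a)))
        same = trans (lookup-index (mem (toℕ a))) (trans (cong (lookup (subs G)) eq) (sym (lookup-index (mem (toℕ b)))))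
        T = chain (toℕ a)
    in irr (root T) (sub T) (subst (_≻ pos T) (sym same) (chain-increasing (<⇒<′ a<b)))
    where
    mem : ∀ k → pos (chain k) ∈ subs G
    mem k = Sub⇒∈subs (sub′ (chain k))

≻-conj : ∀ G → conj G ≻ conj G → G ≻ G
≻-conj G = ≅-LS (≅-trans (+-cong ≅-refl (conj-involutive G)) (+-comm (conj G) G))

≻-conj⁻ : ∀ G → G ≻ G → conj G ≻ conj G
≻-conj⁻ G = ≅-LS (≅-sym (≅-trans (+-cong ≅-refl (conj-involutive G)) (+-comm (conj G) G)))

-- By 𝓟-freeness Left cannot win both `G` and `conj G` moving second, and the argument above applies
-- to one that she does not win.
≻-irrefl-step : ∀ G → Nice G → (∀ i {M} → Sub (optL G i) M → ¬ M ≻ M) → (∀ j {M} → Sub (optR G j) M → ¬ M ≻ M) →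
                ¬ G ≻ G
≻-irrefl-step G@(mk _ _ _ R) nice irrL irrR p with LS? G
... | no ¬q = NoSelfDomination.contradiction G nice ¬q p irrL
... | yes q = NoSelfDomination.contradiction (conj G) (Nice-conj G nice)
  (λ r → LS-conj⇒¬LF G r (proj₂ nice here q)) (≻-conj⁻ G p)
  (λ j → Sub-conj (R j) (λ M → ¬ M ≻ M) (λ {M} s r → irrR j s (≻-conj M r)))

-- Stated for all subpositions, since the induction step needs every proper subposition and not only
-- the options.
≻-irrefl-Sub : ∀ G → Nice G → ∀ {H} → Sub G H → ¬ H ≻ H
≻-irrefl-Sub G@(mk _ _ L R) nice here = ≻-irrefl-step G nice
  (λ i → ≻-irrefl-Sub (L i) (Nice-Sub nice (viaL i here)))
  (λ j → ≻-irrefl-Sub (R j) (Nice-Sub nice (viaR j here)))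
≻-irrefl-Sub (mk _ _ L _) nice (viaL i s) = ≻-irrefl-Sub (L i) (Nice-Sub nice (viaL i here)) s
≻-irrefl-Sub (mk _ _ _ R) nice (viaR j s) = ≻-irrefl-Sub (R j) (Nice-Sub nice (viaR j here)) s

≻-irrefl : ∀ G → Nice G → ¬ G ≻ G
≻-irrefl G nice = ≻-irrefl-Sub G nice here

-- A sum G + H of outcome 𝓟 would give both G ≻ −H and −H ≻ G.
+-not𝓟 : ∀ G H → Nice G → Nice H → LS (G + H) → LF (G + H)
+-not𝓟 G H g h p with leftFirst (G + H) Bool.≟ true
... | yes q = q
... | no ¬q = ⊥-elim (≻-irrefl G g (≻-trans G (conj H) G g (Nice-conj H h) g
  (≅-LS (+-cong (≅-refl {G}) (≅-sym (conj-involutive H))) p)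
  (≅-LS (≅-trans (conj-+ G H) (+-comm (conj G) (conj H))) (¬LF⇒LS-conj (G + H) ¬q))))

Nice-+ : ∀ G H → Nice G → Nice H → Nice (G + H)
Nice-+ G H g h = Blocking-+ G H (proj₁ g) (proj₁ h) ,
  Sub-+ G H (λ K → LS K → LF K) (λ {G'} {H'} s t → +-not𝓟 G' H' (Nice-Sub g s) (Nice-Sub h t))

-- Left answers in G + conj G by mirroring; once X is a blocked Left end, she wins G + conj G moving first instead.
mutual
  mirror-LS : ∀ G X → Nice G → Blocking X → LS X → LS (G + conj G + X)
  mirror-LS G@(mk _ _ L R) X@(mk _ _ _ R') g b p =
    LS-intro (G + conj G + X) (LS-nonend X p ∘ proj₂ ∘ RightEnd-+⁻ (G + conj G) X)
      (sumR-elim LF (G + conj G) X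
        (sumR-elim (λ Z → LF (Z + X)) G (conj G)
          (λ j → reply (R j + conj G) (sumLʳ (λ Z → LS (Z + X)) (R j) (conj G) j
                   (mirror-LS (R j) X (Nice-Sub g (viaR j here)) b p)))
          (λ i → reply (G + conj (L i)) (sumLˡ (λ Z → LS (Z + X)) G (conj (L i)) i
                   (mirror-LS (L i) X (Nice-Sub g (viaL i here)) b p))))
        (λ j → mirror-LF G (R' j) g (λ K s → b K (viaR j s)) (LS-reply X p j)))
    where
    reply : ∀ K → ∃ (λ k → LS (optL K k + X)) → LF (K + X)
    reply K (k , q) = LF-move (K + X) (sumLˡ LS K X k q)

  mirror-LF : ∀ G X → Nice G → Blocking X → LF X → LF (G + conj G + X)
  mirror-LF G X@(mk _ _ L _) g b p =
    -- `blocked-LF` asks for 𝓟-freeness of the whole sum `G + conj G`, supplied by `Nice-+`.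
    [ (λ e → blocked-LF (G + conj G) X (proj₂ (Nice-+ G (conj G) g (Nice-conj G g))) (proj₁ (b X here) e)
               (¬≻⇒⊳ G G (≻-irrefl G g)))
    , (λ (i , q) → LF-move (G + conj G + X)
        (sumLʳ LS (G + conj G) X i (mirror-LS G (L i) g (λ K s → b K (viaL i s)) q))) ]′ (LF-cases X p)

-- Outcome order and equivalence modulo blocking games

-- The outcome order is the componentwise order on the two winning conditions.
≥o-intro : ∀ G H → (LF H → LF G) → (LS H → LS G) → o G ≥o o H
≥o-intro G H f g with leftFirst G | leftSecond G | leftFirst H | leftSecond H
... | true  | true  | _     | _     = 𝓛≥
... | _     | _     | false | false = ≥𝓡
... | true  | false | true  | false = ≥o-refl
... | false | true  | false | true  = ≥o-refl
... | false | _     | true  | _     with () ← f refl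
... | _     | false | _     | true  with () ← g refl

≥o-trans : ∀ {x y z} → x ≥o y → y ≥o z → x ≥o z
≥o-trans ≥o-refl q = q
≥o-trans 𝓛≥ _ = 𝓛≥
≥o-trans ≥𝓡 ≥o-refl = ≥𝓡
≥o-trans ≥𝓡 ≥𝓡 = ≥𝓡

≡⇒≥o : ∀ {x y} → x ≡ y → x ≥o y
≡⇒≥o refl = ≥o-refl

≥B-trans : ∀ G H K → G ≥B H → H ≥B K → G ≥B K
≥B-trans _ _ _ p q X b = ≥o-trans (p X b) (q X b)

≡B-trans : ∀ G H K → G ≡B H → H ≡B K → G ≡B K
≡B-trans G H K (p , p′) (q , q′) = ≥B-trans G H K p q , ≥B-trans K H G q′ p′

≡B-refl : ∀ G → G ≡B G
≡B-refl _ = (λ _ _ → ≥o-refl) , (λ _ _ → ≥o-refl)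

≅⇒≡B : ∀ {G H} → G ≅ H → G ≡B H
≅⇒≡B p = (λ X _ → ≡⇒≥o (≅-o (+-cong p ≅-refl))) , (λ X _ → ≡⇒≥o (≅-o (+-cong (≅-sym p) ≅-refl)))

-- `K + X` is again blocking, so it may serve as the test game.
≥B-+ʳ : ∀ G H K → Blocking K → G ≥B H → (G + K) ≥B (H + K)
≥B-+ʳ G H K k p X b = ≥o-trans (≡⇒≥o (≅-o (+-assoc G K X)))
  (≥o-trans (p (K + X) (Blocking-+ K X k b)) (≡⇒≥o (≅-o (≅-sym (+-assoc H K X)))))

≡B-+ʳ : ∀ G H K → Blocking K → G ≡B H → (G + K) ≡B (H + K)
≡B-+ʳ G H K k (p , q) = ≥B-+ʳ G H K k p , ≥B-+ʳ H G K k q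

≡B-+ : ∀ G G' H H' → Blocking G' → Blocking H → G ≡B G' → H ≡B H' → (G + H) ≡B (G' + H')
≡B-+ G G' H H' g' h p q =
  ≡B-trans (G + H) (G' + H) (G' + H') (≡B-+ʳ G G' H h p)
    (≡B-trans (G' + H) (H + G') (G' + H') (≅⇒≡B (+-comm G' H))
      (≡B-trans (H + G') (H' + G') (G' + H') (≡B-+ʳ H H' G' g' q) (≅⇒≡B (+-comm H' G'))))

-- Mirroring gives one inequality. For the other, Right mirrors: G - G is its own conjugate up to ≅,
-- so mirroring is applied to `conj X`.
conj-inverse : ∀ G → Nice G → (G + conj G) ≡B 𝟘
conj-inverse G g = ge , le
  where
  ge : (G + conj G) ≥B 𝟘
  ge X b = ≥o-intro (G + conj G + X) (𝟘 + X)
    (mirror-LF G X g b ∘ ≅-LF (+-identityˡ X)) (mirror-LS G X g b ∘ ≅-LS (+-identityˡ X))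

  conj-mirror : ∀ X → conj (G + conj G + conj X) ≅ G + conj G + X
  conj-mirror X = ≅-trans (conj-+ (G + conj G) (conj X)) (+-cong (conj-diff G G) (conj-involutive X))

  le : 𝟘 ≥B (G + conj G)
  le X b = ≥o-intro (𝟘 + X) (G + conj G + X) (≅-LF (≅-sym (+-identityˡ X)) ∘ first) (≅-LS (≅-sym (+-identityˡ X)) ∘ second)
    where
    Y = G + conj G + conj X
    b′ = Blocking-conj X b
    first : LF (G + conj G + X) → LF X
    first p with leftFirst X Bool.≟ true
    ... | yes q = q
    ... | no ¬q = ⊥-elim (LF-conj⇒¬LS Y (≅-LF (≅-sym (conj-mirror X)) p)
                    (mirror-LS G (conj X) g b′ (¬LF⇒LS-conj X ¬q)))
    second : LS (G + conj G + X) → LS X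
    second p with LS? X
    ... | yes q = q
    ... | no ¬q = ⊥-elim (LS-conj⇒¬LF Y (≅-LS (≅-sym (conj-mirror X)) p)
                    (mirror-LF G (conj X) g b′ (¬LS⇒LF-conj X ¬q)))

-- The subgroup of invertible classes

StrictlyPFree⇒PFree : ∀ {G} → StrictlyPFree G → PFree G
StrictlyPFree⇒PFree f {H} s p with leftFirst H in eq
... | true = refl
... | false = ⊥-elim (f H s (cong₂ outcomeOf eq p))

PFree⇒StrictlyPFree : ∀ {G} → PFree G → StrictlyPFree G
PFree⇒StrictlyPFree f H s e with leftFirst H | leftSecond H | f s | e
... | false | true  | g | _ with () ← g refl
... | true  | true  | _ | ()
... | true  | false | _ | ()
... | false | false | _ | ()

Nice⇒InPB : ∀ G → Nice G → InPB G
Nice⇒InPB G (b , pf) = b , G , b , PFree⇒StrictlyPFree pf , ≡B-refl G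

-- `G` itself may have subpositions of outcome 𝓟, so the inverse is the conjugate of its 𝓟-free
-- representative `H`.
InPB-inverse : ∀ G → InPB G → Σ Game (λ K → InPB K × ((G + K) ≡B 𝟘))
InPB-inverse G (_ , H , b , pf , e) = conj H , Nice⇒InPB (conj H) h′ ,
  ≡B-trans (G + conj H) (H + conj H) 𝟘 (≡B-+ʳ G H (conj H) (proj₁ h′) e) (conj-inverse H h)
  where
  h : Nice H
  h = b , StrictlyPFree⇒PFree pf
  h′ = Nice-conj H h

InPB-+ : ∀ G H → InPB G → InPB H → InPB (G + H)
InPB-+ G H (g , G' , g' , gf , p) (h , H' , h' , hf , q) =
  let b , pf = Nice-+ G' H' (g' , StrictlyPFree⇒PFree gf) (h' , StrictlyPFree⇒PFree hf)
  in Blocking-+ G H g h , G' + H' , b , PFree⇒StrictlyPFree pf , ≡B-+ G G' H H' g' h p q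

Nice-𝟘 : Nice 𝟘
Nice-𝟘 = (λ { _ here → (λ _ ()) , (λ _ ()) }) , (λ { here () })

InPB⇒Invertible : ∀ G → InPB G → Invertible G
InPB⇒Invertible G g = let K , (k , _) , e = InPB-inverse G g in proj₁ g , K , k , e

theorem4p12 : (∀ G → InPB G → Invertible G) × SubgroupOfUnits InPB
theorem4p12 =
  InPB⇒Invertible ,
  InPB⇒Invertible ,
  (𝟘 , Nice⇒InPB 𝟘 Nice-𝟘 , ≡B-refl 𝟘) ,
  (λ G H g h → G + H , InPB-+ G H g h , ≡B-refl (G + H)) ,
  InPB-inverse
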